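{- Let $s,t$ be two integers, let $k$ be a positive integer, and let $T$ be a tree of order $s$. Then $$\operatorname{gr}_k(T,K_t)\leq (s-1)^{kt}.$$
   Context: The order of a graph is its number of vertices. A $k$-edge-coloring of $K_n$ assigns to each edge one of $k$ colors (not all colors need be used, and it need not be proper). A subgraph is rainbow if all its edges have distinct colors, and monochromatic if all its edges have the same color. For graphs $G,H$ and a positive integer $k$, the Gallai-Ramsey number $\operatorname{gr}_k(G,H)$ is the minimum integer $n$ such that every $k$-edge-coloring of the complete graph $K_n$ contains a rainbow copy of $G$ or a monochromatic copy of $H$.
   Formalization: The order s of the tree is assumed to be at least 3, because the bound fails for smaller trees: for s=1, t≥1 it gives 0 while the number is 1, and for s=2, t≥2 it gives 1 while the number is 2. -}

module Defs where

open import Data.Nat.Base using (ℕ; _≤_; _+_)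
open import Data.Fin.Base using (Fin; zero; suc; inject₁; fromℕ)
open import Data.Fin.Properties using (_≟_)
open import Data.Product.Base using (_×_; Σ-syntax; ∃)
open import Data.Sum.Base using (_⊎_)
open import Function.Definitions using (Injective)
open import Level using (0ℓ)
open import Relation.Binary.Core using (Rel)
open import Relation.Binary.Definitions using (Decidable; Irreflexive; Symmetric)
open import Relation.Binary.Construct.Closure.ReflexiveTransitive using (Star)
open import Relation.Binary.PropositionalEquality using (_≡_; _≢_; ≢-sym)
open import Relation.Nullary using (¬_)
open import Relation.Nullary.Decidable using (¬?)

-- Finite simple graphs of order n.  Adjacency is decidable, as it is for any
-- explicitly given finite graph.
record Graph (n : ℕ) : Set₁ where
  infix 4 _~_
  field
    _~_    : Rel (Fin n) 0ℓ
    sym    : Symmetric _~_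
    irrefl : Irreflexive _≡_ _~_
    _~?_   : Decidable _~_

K : ∀ n → Graph n
K n = record
  { _~_    = _≢_
  ; sym    = ≢-sym
  ; irrefl = λ eq neq → neq eq
  ; _~?_   = λ u v → ¬? (u ≟ v)
  }

module _ {n : ℕ} (G : Graph n) where
  open Graph G

  -- The null graph is not connected.
  Connected : Set
  Connected = Fin n × (∀ u v → Star _~_ u v)

  -- A cycle of length 3 + m, as the sequence of its distinct vertices.
  record Cycle : Set where
    field
      m        : ℕ
      vertex   : Fin (3 + m) → Fin n
      distinct : Injective _≡_ _≡_ vertex
      step     : ∀ (i : Fin (2 + m)) → vertex (inject₁ i) ~ vertex (suc i)
      close    : vertex (fromℕ (2 + m)) ~ vertex zero

  IsTree : Set
  IsTree = Connected × ¬ Cycle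

-- A k-edge-coloring of K n.  The color of the edge uv is color u v; the
-- diagonal values color u u carry no meaning and are never inspected below
-- (for k ≥ 1 they can be chosen arbitrarily, so no coloring is lost).
record Coloring (k n : ℕ) : Set where
  field
    color     : Fin n → Fin n → Fin k
    color-sym : ∀ u v → color u v ≡ color v u

-- A copy of G in K n: any injection of vertices maps edges to edges of K n.
record Copy {m : ℕ} (G : Graph m) (n : ℕ) : Set where
  field
    embed     : Fin m → Fin n
    injective : Injective _≡_ _≡_ embed

module _ {k m n : ℕ} (c : Coloring k n) {G : Graph m} (φ : Copy G n) where
  open Graph G
  open Coloring c
  open Copy φ

  -- Edges with equal colors coincide as unordered pairs.
  Rainbow : Set
  Rainbow = ∀ {u v x y} → u ~ v → x ~ y →
    color (embed u) (embed v) ≡ color (embed x) (embed y) →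
    (u ≡ x × v ≡ y) ⊎ (u ≡ y × v ≡ x)

  Monochromatic : Set
  Monochromatic = ∀ {u v x y} → u ~ v → x ~ y →
    color (embed u) (embed v) ≡ color (embed x) (embed y)

GallaiRamseyProperty : ∀ {a b} → ℕ → Graph a → Graph b → ℕ → Set
GallaiRamseyProperty k G H n = (c : Coloring k n) →
  (Σ[ φ ∈ Copy G n ] Rainbow c φ) ⊎ (Σ[ φ ∈ Copy H n ] Monochromatic c φ)

-- n = gr_k(G, H).
record IsGallaiRamseyNumber {a b} (k : ℕ) (G : Graph a) (H : Graph b) (n : ℕ) : Set where
  field
    holds   : GallaiRamseyProperty k G H n
    minimal : ∀ m → GallaiRamseyProperty k G H m → n ≤ m

-- gr_k(G, H) ≤ N, including that gr_k(G, H) exists.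
GallaiRamseyNumber≤ : ∀ {a b} → ℕ → Graph a → Graph b → ℕ → Set
GallaiRamseyNumber≤ k G H N = ∃ λ n → IsGallaiRamseyNumber k G H n × n ≤ N

{-# OPTIONS --safe #-}
-- Put b = s ∸ 1.  More generally, b ^ (t₁ + … + t_k) vertices force a rainbow T
-- or, for some i, a clique of order tᵢ in color i.  If some vertex has degree at
-- least b ^ (m ∸ 1) in color i among b ^ m vertices, recurse into that
-- neighborhood with tᵢ lowered by one.  Otherwise let Q = b ^ (m ∸ 1): order T so
-- that each vertex is a leaf when it is added, and embed greedily.  Attaching
-- the next leaf excludes at most the ≤ b embedded vertices and the ≤ b ∸ 1
-- neighborhoods, of size ≤ Q ∸ 1, in the colors already used; for m ≥ 2 this is
-- b + (b ∸ 1) * (Q ∸ 1) < b * Q, so a vertex is left; for m = 1 any edge gives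
-- the large degree.  The least such number of vertices exists constructively
-- because there are finitely many colorings and the property is decidable.
module Submission where

open import Defs
open import Data.Nat.Base using (ℕ; _≤_; _∸_; _*_; _^_)

open import Data.Fin.Base using (Fin; zero; suc; inject₁; fromℕ; fromℕ<; finToFun; funToFin)
open import Data.Fin.Properties using (_≟_; all?; any?; finToFun-funToFin)
open import Data.List.Base
  using (List; []; _∷_; _++_; length; lookup; filter; map; concatMap)
open import Data.List.Membership.Propositional using (_∈_; _∉_; find; lose)
open import Data.List.Membership.Propositional.Properties
  using (∈-filter⁺; ∈-filter⁻; ∈-allFin; ∈-map⁺; ∈-++⁺ˡ; ∈-++⁺ʳ; ∈-lookup; ∈-concatMap⁺)
import Data.List.Membership.DecPropositional as DecMembership
open import Data.List.Properties
  using (length-++; length-map; length-tabulate; filter-notAll; filter-some)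
open import Data.List.Relation.Binary.Subset.Propositional using (_⊆_)
open import Data.List.Relation.Unary.All as All using ([]; _∷_)
open import Data.List.Relation.Unary.All.Properties using (¬Any⇒All¬)
open import Data.List.Relation.Unary.AllPairs using ([]; _∷_)
open import Data.List.Relation.Unary.Any as Any using (here; there)
open import Data.List.Relation.Unary.Unique.Propositional using (Unique)
open import Data.List.Relation.Unary.Unique.Propositional.Properties using (filter⁺; allFin⁺)
open import Data.Nat.Base using (zero; suc; _+_; _<_; z≤n; s≤s)
import Data.Nat.Properties as ℕ
open import Data.Product.Base using (_×_; _,_; proj₁; proj₂; ∃; ∃₂; Σ-syntax; -,_)
open import Data.Sum.Base as Sum using (_⊎_; inj₁; inj₂)
open import Data.Vec.Base as Vec using (Vec; _∷_; _[_]≔_; replicate; sum)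
open import Data.Vec.Functional using (updateAt)
open import Data.Vec.Functional.Properties using (updateAt-updates; updateAt-minimal)
open import Data.Vec.Properties using (lookup∘update; lookup∘update′; lookup-replicate)
open import Function.Base using (_∘_; const)
open import Function.Definitions using (Injective)
open import Level using (0ℓ)
open import Relation.Binary.Construct.Closure.ReflexiveTransitive
  using (Star; ε; _◅_; _◅◅_; gmap)
open import Relation.Binary.Core using (Rel)
open import Relation.Binary.PropositionalEquality
  using (_≡_; _≢_; refl; sym; trans; cong; cong₂; subst; _≗_)
open import Relation.Nullary using (¬_; Dec; yes; no)
open import Relation.Nullary.Decidable using (¬?; _×-dec_; _⊎-dec_; _→-dec_; map′; decidable-stable)
open import Relation.Nullary.Negation using (contradiction)
open import Relation.Unary using (Pred; Decidable)

private
  variable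
    k m n : ℕ

module _ {n : ℕ} where
  open DecMembership (_≟_ {n}) public using (_∈?_)

-- Least witnesses, counting in lists, and arithmetic

-- Upward search from 0, shifting `P` at each failure; the known witness `N` bounds the recursion.
least : (P : Pred ℕ 0ℓ) → Decidable P → ∀ N → P N →
        ∃ λ n → (P n × (∀ m → P m → n ≤ m)) × n ≤ N
least P P? zero    p = zero , (p , λ _ _ → z≤n) , z≤n
least P P? (suc N) p with P? zero
... | yes p₀ = zero , (p₀ , λ _ _ → z≤n) , z≤n
... | no ¬p₀ with least (P ∘ suc) (P? ∘ suc) N p
...   | n , (pn , min) , n≤N = suc n , (pn , min′) , s≤s n≤N
  where
  min′ : ∀ m → P m → suc n ≤ m
  min′ zero    q = contradiction q ¬p₀
  min′ (suc m) q = s≤s (min m q)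

-- Pigeonhole: deleting `x` from `ys` shortens it strictly, and keeps all of `xs`, whose entries
-- differ from `x`.
Unique-⊆⇒length≤ : {xs ys : List (Fin n)} → Unique xs → xs ⊆ ys → length xs ≤ length ys
Unique-⊆⇒length≤ []                  _     = z≤n
Unique-⊆⇒length≤ {xs = x ∷ xs} {ys} (x∉xs ∷ u) xs⊆ys = ℕ.≤-<-trans
  (Unique-⊆⇒length≤ u λ z∈xs →
    ∈-filter⁺ (λ z → ¬? (x ≟ z)) (xs⊆ys (there z∈xs)) (All.lookup x∉xs z∈xs))
  (filter-notAll (λ z → ¬? (x ≟ z)) ys (lose (xs⊆ys (here refl)) λ x≢x → x≢x refl))

Unique⇒length≤ : {xs : List (Fin n)} → Unique xs → length xs ≤ n
Unique⇒length≤ {n} u =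
  ℕ.≤-trans (Unique-⊆⇒length≤ u λ {x} _ → ∈-allFin x) (ℕ.≤-reflexive (length-tabulate (λ x → x)))

∉∷Unique : {x : Fin n} {xs : List (Fin n)} → x ∉ xs → Unique xs → Unique (x ∷ xs)
∉∷Unique x∉xs u = ¬Any⇒All¬ _ x∉xs ∷ u

length-concatMap≤ : {A B : Set} {d : ℕ} (f : A → List B) → (∀ a → length (f a) ≤ d) →
                    ∀ xs → length (concatMap f xs) ≤ length xs * d
length-concatMap≤ f f≤d []       = z≤n
length-concatMap≤ f f≤d (x ∷ xs) = ℕ.≤-trans
  (ℕ.≤-reflexive (length-++ (f x)))
  (ℕ.+-mono-≤ (f≤d x) (length-concatMap≤ f f≤d xs))

lookup≤sum : (t : Vec ℕ k) (i : Fin k) → Vec.lookup t i ≤ sum t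
lookup≤sum (a ∷ t) zero    = ℕ.m≤m+n a (sum t)
lookup≤sum (a ∷ t) (suc i) = ℕ.≤-trans (lookup≤sum t i) (ℕ.m≤n+m (sum t) a)

sum-decrement : (t : Vec ℕ k) (i : Fin k) {a : ℕ} → Vec.lookup t i ≡ suc a →
                sum t ≡ suc (sum (t [ i ]≔ a))
sum-decrement (b ∷ t) zero    refl = refl
sum-decrement (b ∷ t) (suc i) {a} eq =
  trans (cong (b +_) (sum-decrement t i eq)) (ℕ.+-suc b (sum (t [ i ]≔ a)))

sum-replicate : ∀ k t → sum (replicate k t) ≡ k * t
sum-replicate zero    t = refl
sum-replicate (suc k) t = cong (t +_) (sum-replicate k t)

-- Here `suc q` is the degree threshold and `l` the number of colors already used. The left side
-- equals `1 + l * suc q`, and `1 < suc q` gives strictness.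
room-to-attach : ∀ {b q l} → 1 ≤ q → suc l < suc b → suc l + l * q < b * suc q
room-to-attach {b} {q} {l} 1≤q (s≤s l<b) = begin-strict
  suc l + l * q     ≡⟨ cong suc (sym (ℕ.*-suc l q)) ⟩
  suc (l * suc q)   <⟨ ℕ.+-monoˡ-< (l * suc q) (s≤s 1≤q) ⟩
  suc q + l * suc q ≤⟨ ℕ.*-monoˡ-≤ (suc q) l<b ⟩
  b * suc q         ∎
  where
  open ℕ.≤-Reasoning

-- Trees

module _ {n : ℕ} (G : Graph n) where
  open Graph G using (_~_) renaming (sym to ~-sym)

  -- Path x z ys is a path with distinct vertices x ∷ ys ending in z.
  data Path : Fin n → Fin n → List (Fin n) → Set where
    done : ∀ {x} → Path x x []
    step : ∀ {x y z ys} → x ~ y → x ∉ y ∷ ys → Path y z ys → Path x z (y ∷ ys)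

  path-adjacent : ∀ {x z ys} → Path x z ys → (i : Fin (length ys)) →
                  lookup (x ∷ ys) (inject₁ i) ~ lookup (x ∷ ys) (suc i)
  path-adjacent (step x~y _ p) zero    = x~y
  path-adjacent (step x~y _ p) (suc i) = path-adjacent p i

  path-last : ∀ {x z ys} → Path x z ys → lookup (x ∷ ys) (fromℕ (length ys)) ≡ z
  path-last done         = refl
  path-last (step _ _ p) = path-last p

  path-injective : ∀ {x z ys} → Path x z ys → Injective _≡_ _≡_ (lookup (x ∷ ys))
  path-injective p              {zero}  {zero}  eq = refl
  path-injective (step _ x∉ p) {zero}  {suc j} eq =
    contradiction (subst (_∈ _) (sym eq) (∈-lookup j)) x∉
  path-injective (step _ x∉ p) {suc i} {zero}  eq =
    contradiction (subst (_∈ _) eq (∈-lookup i)) x∉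
  path-injective (step _ _ p)  {suc i} {suc j} eq = cong suc (path-injective p eq)

  -- Two vertices after `x` are required so that the closing edge does not retrace the path; a cycle
  -- then has `3 + length ys` vertices.
  close-path : ∀ {x z y y′ ys} → Path x z (y ∷ y′ ∷ ys) → z ~ x → Cycle G
  close-path {x} {ys = ys} p z~x = record
    { m        = length ys
    ; vertex   = lookup (x ∷ _ ∷ _ ∷ ys)
    ; distinct = path-injective p
    ; step     = path-adjacent p
    ; close    = subst (_~ x) (sym (path-last p)) z~x
    }

  path-suffix : ∀ {x y z ys} → x ∈ y ∷ ys → Path y z ys → ∃ λ ys′ → Path x z ys′ × ys′ ⊆ ys
  path-suffix (here refl) p            = -, p , λ m → m
  path-suffix (there x∈)  (step _ _ p) with path-suffix x∈ p
  ... | ys′ , p′ , ys′⊆ = ys′ , p′ , there ∘ ys′⊆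

  -- Adjacency in the subgraph induced on `xs`. Both endpoints are recorded so that a path extracted
  -- from such a walk avoids every vertex outside `xs`.
  Within : List (Fin n) → Rel (Fin n) 0ℓ
  Within xs x y = x ∈ xs × y ∈ xs × x ~ y

  -- Loop erasure: if `x` recurs on the path from `y`, only the part from that occurrence on is
  -- kept.
  walk⇒path : ∀ {xs x z} → Star (Within xs) x z → ∃ λ ys → Path x z ys × ys ⊆ xs
  walk⇒path ε = [] , done , λ ()
  walk⇒path {xs} {x} (_◅_ {j = y} (x∈ , y∈ , x~y) w) with walk⇒path w
  ... | ys , p , ys⊆ with x ∈? (y ∷ ys)
  ...   | no x∉ = y ∷ ys , step x~y x∉ p , λ { (here refl) → y∈ ; (there m) → ys⊆ m }
  ...   | yes x∈ys with path-suffix x∈ys p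
  ...     | ys′ , p′ , ys′⊆ = ys′ , p′ , ys⊆ ∘ ys′⊆

  -- The newest vertex stands first and has exactly one neighbor, its parent `u`, among the earlier
  -- ones. Read from the head, this is an order in which leaves can be removed.
  data LeafOrder : List (Fin n) → Set where
    root   : ∀ r → LeafOrder (r ∷ [])
    attach : ∀ {w u xs} → w ∉ xs → u ∈ xs → w ~ u →
             (∀ {x} → x ∈ xs → w ~ x → x ≡ u) →
             LeafOrder xs → LeafOrder (w ∷ xs)

  leafOrder-unique : ∀ {xs} → LeafOrder xs → Unique xs
  leafOrder-unique (root r)               = [] ∷ []
  leafOrder-unique (attach w∉xs _ _ _ o) = ∉∷Unique w∉xs (leafOrder-unique o)

  leafOrder-connected : ∀ {xs x y} → LeafOrder xs → x ∈ xs → y ∈ xs → Star (Within xs) x y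
  leafOrder-connected (root r) (here refl) (here refl) = ε
  leafOrder-connected (attach {w} {u} {xs} _ u∈ w~u _ o) = walk
    where
    weaken : ∀ {x y} → Star (Within xs) x y → Star (Within (w ∷ xs)) x y
    weaken = gmap (λ v → v) λ (x∈ , y∈ , x~y) → there x∈ , there y∈ , x~y
    walk : ∀ {x y} → x ∈ w ∷ xs → y ∈ w ∷ xs → Star (Within (w ∷ xs)) x y
    walk (here refl) (here refl) = ε
    walk (here refl) (there y∈)  =
      (here refl , there u∈ , w~u) ◅ weaken (leafOrder-connected o u∈ y∈)
    walk (there x∈)  (here refl) =
      weaken (leafOrder-connected o x∈ u∈) ◅◅ (there u∈ , here refl , ~-sym w~u) ◅ ε
    walk (there x∈)  (there y∈)  = weaken (leafOrder-connected o x∈ y∈)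

  crossing-edge : ∀ {xs x y} → Star _~_ x y → x ∈ xs → y ∉ xs →
                  ∃₂ λ u w → u ∈ xs × w ∉ xs × w ~ u
  crossing-edge ε x∈ y∉ = contradiction x∈ y∉
  crossing-edge {xs} (_◅_ {j = v} x~v walk) x∈ y∉ with v ∈? xs
  ... | yes v∈ = crossing-edge walk v∈ y∉
  ... | no  v∉ = -, v , x∈ , v∉ , ~-sym x~v

  -- Two distinct neighbors of `w` in `xs` are joined by a path inside `xs`. This path misses `w`,
  -- so going through `w` closes it to a cycle.
  attached-once : ¬ Cycle G → ∀ {xs u w x} → LeafOrder xs → w ∉ xs → u ∈ xs → w ~ u →
                  x ∈ xs → w ~ x → x ≡ u
  attached-once acyclic {xs} {u} {w} {x} o w∉ u∈ w~u x∈ w~x with x ≟ u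
  ... | yes x≡u = x≡u
  ... | no  x≢u with walk⇒path (leafOrder-connected o u∈ x∈)
  ...   | [] , done , _ = contradiction refl x≢u
  ...   | ys@(_ ∷ _) , p , ys⊆ = contradiction (close-path (step w~u w∉u∷ys p) (~-sym w~x)) acyclic
    where
    w∉u∷ys : w ∉ u ∷ ys
    w∉u∷ys (here refl) = w∉ u∈
    w∉u∷ys (there w∈)  = w∉ (ys⊆ w∈)

  leafOrder-head : ∀ {xs} → LeafOrder xs → ∃ (_∈ xs)
  leafOrder-head (root r)           = r , here refl
  leafOrder-head (attach _ _ _ _ _) = -, here refl

  -- `d` bounds the number of vertices still missing. While one is missing, connectedness yields an
  -- edge leaving `xs`, whose outer end is attached next.
  leafOrder-complete : IsTree G → ∀ d {xs} → LeafOrder xs → n ≤ d + length xs →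
                       ∃ λ ys → LeafOrder ys × (∀ v → v ∈ ys)
  leafOrder-complete tree d {xs} o n≤ with any? (λ v → ¬? (v ∈? xs))
  ... | no all∈ = xs , o , λ v → decidable-stable (v ∈? xs) λ v∉ → all∈ (v , v∉)
  leafOrder-complete tree zero {xs} o n≤ | yes (v , v∉) =
    contradiction (Unique⇒length≤ (∉∷Unique v∉ (leafOrder-unique o))) (ℕ.<⇒≱ (s≤s n≤))
  leafOrder-complete tree@((_ , connected) , acyclic) (suc d) {xs} o n≤ | yes (v , v∉)
    with r , r∈ ← leafOrder-head o
    with u , w , u∈ , w∉ , w~u ← crossing-edge (connected r v) r∈ v∉ =
    leafOrder-complete tree d (attach w∉ u∈ w~u (attached-once acyclic o w∉ u∈ w~u) o)
      (ℕ.≤-trans n≤ (ℕ.≤-reflexive (sym (ℕ.+-suc d (length xs)))))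

  tree⇒leafOrder : IsTree G → ∃ λ xs → LeafOrder xs × (∀ v → v ∈ xs)
  tree⇒leafOrder tree@((r , _) , _) =
    leafOrder-complete tree n (root r) (ℕ.m≤m+n n 1)

-- Rainbow trees and monochromatic cliques

module _ {k n : ℕ} (c : Coloring k n) where
  open Coloring c

  -- `z ≢ v` is demanded because the diagonal value `color v v` is arbitrary and may equal `i`.
  nbr? : ∀ i v → Decidable (λ z → z ≢ v × color v z ≡ i)
  nbr? i v z = ¬? (z ≟ v) ×-dec (color v z ≟ i)

  nbrs : Fin k → Fin n → List (Fin n) → List (Fin n)
  nbrs i v = filter (nbr? i v)

  -- Otherwise `A` and the neighborhoods of `v` in the colors of `cs` would cover `V`, against the
  -- size bound.
  fresh-vertex : ∀ {q V} → Unique V → ∀ v → (∀ i → length (nbrs i v V) ≤ q) →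
                 ∀ A cs → v ∈ A → length A + length cs * q < length V →
                 ∃ λ z → z ∈ V × z ∉ A × color v z ∉ cs
  fresh-vertex {q} {V} uV v deg≤ A cs v∈A big
    with Any.any? (λ z → ¬? (z ∈? A) ×-dec ¬? (color v z ∈? cs)) V
  ... | yes found = find found
  ... | no  none  = contradiction (Unique-⊆⇒length≤ uV cover) (ℕ.<⇒≱ (ℕ.≤-<-trans covered≤ big))
    where
    covered = A ++ concatMap (λ i → nbrs i v V) cs
    covered≤ : length covered ≤ length A + length cs * q
    covered≤ = ℕ.≤-trans (ℕ.≤-reflexive (length-++ A))
      (ℕ.+-monoʳ-≤ (length A) (length-concatMap≤ _ deg≤ cs))
    cover : V ⊆ covered
    cover {z} z∈V with z ∈? A | color v z ∈? cs
    ... | yes z∈A | _       = ∈-++⁺ˡ z∈A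
    -- Since `v` lies in `A`, the vertex `z` differs from `v` and is a genuine neighbor.
    ... | no  z∉A | yes c∈ = ∈-++⁺ʳ A (∈-concatMap⁺ (λ i → nbrs i v V)
      (lose c∈ (∈-filter⁺ (nbr? _ v) z∈V ((λ { refl → z∉A v∈A }) , refl))))
    ... | no  z∉A | no  c∉ = contradiction (lose z∈V (z∉A , c∉)) none

  -- Greedy embedding of a rainbow tree

  module _ {s : ℕ} (T : Graph s) where
    open Graph T using (_~_; irrefl) renaming (sym to ~-sym)

    -- `embed` is total, but only its values on `xs` are constrained. Along a leaf order there is
    -- one edge per vertex after the root, hence the count in `colors-#`.
    record PartialRainbow (V : List (Fin n)) (xs : List (Fin s)) : Set where
      field
        embed     : Fin s → Fin n
        colors    : List (Fin k)
        colors-#  : suc (length colors) ≡ length xs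
        embed∈    : ∀ {x} → x ∈ xs → embed x ∈ V
        injective : ∀ {x y} → x ∈ xs → y ∈ xs → embed x ≡ embed y → x ≡ y
        color∈    : ∀ {x y} → x ∈ xs → y ∈ xs → x ~ y → color (embed x) (embed y) ∈ colors
        rainbow   : ∀ {u v x y} → u ∈ xs → v ∈ xs → x ∈ xs → y ∈ xs → u ~ v → x ~ y →
                    color (embed u) (embed v) ≡ color (embed x) (embed y) →
                    (u ≡ x × v ≡ y) ⊎ (u ≡ y × v ≡ x)

    -- By uniqueness of the parent, `w` brings only the edge to `u`. Its color is outside `colors`,
    -- so no old edge shares it.
    attach-leaf : ∀ {V xs w u} (φ : PartialRainbow V xs) →
                  w ∉ xs → u ∈ xs → w ~ u → (∀ {x} → x ∈ xs → w ~ x → x ≡ u) →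
                  ∀ {z} → z ∈ V → z ∉ map (PartialRainbow.embed φ) xs →
                  color (PartialRainbow.embed φ u) z ∉ PartialRainbow.colors φ →
                  PartialRainbow V (w ∷ xs)
    attach-leaf {V} {xs} {w} {u} φ w∉ u∈ w~u once {z} z∈V z∉ fresh∉ = record
      { embed     = f
      ; colors    = fresh ∷ colors
      ; colors-#  = cong suc colors-#
      ; embed∈    = λ { (here refl) → subst (_∈ V) (sym fw) z∈V
                      ; (there x∈)  → subst (_∈ V) (sym (f-old x∈)) (embed∈ x∈) }
      ; injective = inj
      ; color∈    = color∈′
      ; rainbow   = rainbow′
      }
      where
      open PartialRainbow φ
      f = updateAt embed w (const z)
      fresh = color (embed u) z

      fw : f w ≡ z
      fw = updateAt-updates w embed

      f-old : ∀ {x} → x ∈ xs → f x ≡ embed x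
      f-old {x} x∈ = updateAt-minimal x w embed λ { refl → w∉ x∈ }

      z-fresh : ∀ {x} → x ∈ xs → f x ≢ f w
      z-fresh x∈ eq =
        z∉ (subst (_∈ map embed xs) (trans (sym (f-old x∈)) (trans eq fw)) (∈-map⁺ embed x∈))

      inj : ∀ {x y} → x ∈ w ∷ xs → y ∈ w ∷ xs → f x ≡ f y → x ≡ y
      inj (here refl) (here refl) eq = refl
      inj (here refl) (there y∈)  eq = contradiction (sym eq) (z-fresh y∈)
      inj (there x∈)  (here refl) eq = contradiction eq (z-fresh x∈)
      inj (there x∈)  (there y∈)  eq =
        injective x∈ y∈ (trans (sym (f-old x∈)) (trans eq (f-old y∈)))

      color-old : ∀ {x y} → x ∈ xs → y ∈ xs → color (f x) (f y) ≡ color (embed x) (embed y)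
      color-old x∈ y∈ = cong₂ color (f-old x∈) (f-old y∈)

      -- An edge is either old or the edge between `u` and `w` in one of its two orientations; this
      -- reduces rainbowness to comparing old with new.
      data EdgeView x y : Set where
        old : x ∈ xs → y ∈ xs → EdgeView x y
        new : (x ≡ u × y ≡ w) ⊎ (x ≡ w × y ≡ u) → color (f x) (f y) ≡ fresh → EdgeView x y

      edgeView : ∀ {x y} → x ∈ w ∷ xs → y ∈ w ∷ xs → x ~ y → EdgeView x y
      edgeView (here refl) (here refl) w~w = contradiction w~w (irrefl refl)
      edgeView (here refl) (there y∈)  w~y with refl ← once y∈ w~y =
        new (inj₂ (refl , refl)) (trans (color-sym _ _) (cong₂ color (f-old y∈) fw))
      edgeView (there x∈)  (here refl) x~w with refl ← once x∈ (~-sym x~w) =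
        new (inj₁ (refl , refl)) (cong₂ color (f-old x∈) fw)
      edgeView (there x∈)  (there y∈)  _   = old x∈ y∈

      color∈′ : ∀ {x y} → x ∈ w ∷ xs → y ∈ w ∷ xs → x ~ y → color (f x) (f y) ∈ fresh ∷ colors
      color∈′ x∈ y∈ x~y with edgeView x∈ y∈ x~y
      ... | new _ eq     = here eq
      ... | old x∈′ y∈′ = there (subst (_∈ colors) (sym (color-old x∈′ y∈′)) (color∈ x∈′ y∈′ x~y))

      fresh≢old : ∀ {x y} → x ∈ xs → y ∈ xs → x ~ y → fresh ≢ color (f x) (f y)
      fresh≢old x∈ y∈ x~y eq =
        fresh∉ (subst (_∈ colors) (trans (sym (color-old x∈ y∈)) (sym eq)) (color∈ x∈ y∈ x~y))

      rainbow′ : ∀ {a b x y} → a ∈ w ∷ xs → b ∈ w ∷ xs → x ∈ w ∷ xs → y ∈ w ∷ xs →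
                 a ~ b → x ~ y → color (f a) (f b) ≡ color (f x) (f y) →
                 (a ≡ x × b ≡ y) ⊎ (a ≡ y × b ≡ x)
      rainbow′ a∈ b∈ x∈ y∈ a~b x~y eq with edgeView a∈ b∈ a~b | edgeView x∈ y∈ x~y
      ... | old a∈′ b∈′ | old x∈′ y∈′ = rainbow a∈′ b∈′ x∈′ y∈′ a~b x~y
        (trans (sym (color-old a∈′ b∈′)) (trans eq (color-old x∈′ y∈′)))
      ... | old a∈′ b∈′ | new _ eq′ = contradiction (sym (trans eq eq′)) (fresh≢old a∈′ b∈′ a~b)
      ... | new _ eq′ | old x∈′ y∈′ = contradiction (trans (sym eq′) eq) (fresh≢old x∈′ y∈′ x~y)
      ... | new (inj₁ (refl , refl)) _ | new (inj₁ (refl , refl)) _ = inj₁ (refl , refl)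
      ... | new (inj₁ (refl , refl)) _ | new (inj₂ (refl , refl)) _ = inj₂ (refl , refl)
      ... | new (inj₂ (refl , refl)) _ | new (inj₁ (refl , refl)) _ = inj₂ (refl , refl)
      ... | new (inj₂ (refl , refl)) _ | new (inj₂ (refl , refl)) _ = inj₁ (refl , refl)

    -- Attaching to l + 1 embedded vertices must avoid these vertices and the
    -- neighborhoods of the parent in l colors.
    embed-leafOrder : ∀ {q V} → Unique V → (∀ {v} → v ∈ V → ∀ i → length (nbrs i v V) ≤ q) →
                      ∀ {xs} → LeafOrder T xs →
                      (∀ l → suc l < length xs → suc l + l * q < length V) →
                      0 < length V → PartialRainbow V xs
    embed-leafOrder {V = v ∷ _} uV deg≤ (root r) big _ = record
      { embed     = const v
      ; colors    = []
      ; colors-#  = refl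
      ; embed∈    = λ _ → here refl
      ; injective = λ { (here refl) (here refl) _ → refl }
      ; color∈    = λ { (here refl) (here refl) r~r → contradiction r~r (irrefl refl) }
      ; rainbow   = λ { (here refl) (here refl) _ _ r~r → contradiction r~r (irrefl refl) }
      }
    embed-leafOrder {q} {V} uV deg≤ {w ∷ xs} (attach {u = u} w∉ u∈ w~u once o) big V≢[] =
      let z , z∈V , z∉ , fresh∉ =
            fresh-vertex uV (embed u) (deg≤ (embed∈ u∈)) (map embed xs) colors
              (∈-map⁺ embed u∈) room
      in attach-leaf φ w∉ u∈ w~u once z∈V z∉ fresh∉
      where
      φ = embed-leafOrder uV deg≤ o (λ l l< → big l (ℕ.m<n⇒m<1+n l<)) V≢[]
      open PartialRainbow φ
      room : length (map embed xs) + length colors * q < length V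
      room = subst (λ a → a + length colors * q < length V)
        (trans colors-# (sym (length-map embed xs)))
        (big (length colors) (s≤s (ℕ.≤-reflexive colors-#)))

    RainbowCopy : Set
    RainbowCopy = Σ[ φ ∈ Copy T n ] Rainbow c φ

    fromPartial : ∀ {V xs} → PartialRainbow V xs → (∀ v → v ∈ xs) → RainbowCopy
    fromPartial φ all∈ =
      record { embed = embed ; injective = injective (all∈ _) (all∈ _) } ,
      rainbow (all∈ _) (all∈ _) (all∈ _) (all∈ _)
      where
      open PartialRainbow φ

  -- Cliques in a prescribed color

  -- The color is an index, so that cliques of order 0 and 1, which have no edges, also belong to a
  -- color and can be extended in it.
  record Clique (i : Fin k) (V : List (Fin n)) (a : ℕ) : Set where
    field
      embed     : Fin a → Fin n
      injective : Injective _≡_ _≡_ embed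
      embed∈    : ∀ x → embed x ∈ V
      mono      : ∀ {x y} → x ≢ y → color (embed x) (embed y) ≡ i

  clique-⊆ : ∀ {i V W a} → V ⊆ W → Clique i V a → Clique i W a
  clique-⊆ V⊆W C = record { Clique C ; embed∈ = V⊆W ∘ Clique.embed∈ C }

  clique-0 : ∀ i V {a} → a ≡ 0 → Clique i V a
  clique-0 i V refl = record
    { embed = λ () ; injective = λ { {()} } ; embed∈ = λ () ; mono = λ { {()} } }

  clique-cons : ∀ {i V v a} → v ∈ V → Clique i (nbrs i v V) a → Clique i V (suc a)
  clique-cons {i} {V} {v} {a} v∈V C = record
    { embed = f ; injective = inj ; embed∈ = f∈ ; mono = mono′ }
    where
    open Clique C
    f : Fin (suc a) → Fin n
    f zero    = v
    f (suc x) = embed x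
    nbr : ∀ x → embed x ∈ V × embed x ≢ v × color v (embed x) ≡ i
    nbr x = ∈-filter⁻ (nbr? i v) (embed∈ x)
    inj : Injective _≡_ _≡_ f
    inj {zero}  {zero}  _  = refl
    inj {zero}  {suc y} eq = contradiction (sym eq) (proj₁ (proj₂ (nbr y)))
    inj {suc x} {zero}  eq = contradiction eq (proj₁ (proj₂ (nbr x)))
    inj {suc x} {suc y} eq = cong suc (injective eq)
    f∈ : ∀ x → f x ∈ V
    f∈ zero    = v∈V
    f∈ (suc x) = proj₁ (nbr x)
    mono′ : ∀ {x y} → x ≢ y → color (f x) (f y) ≡ i
    mono′ {zero}  {zero}  0≢0 = contradiction refl 0≢0
    mono′ {zero}  {suc y} _   = proj₂ (proj₂ (nbr y))
    mono′ {suc x} {zero}  _   = trans (color-sym _ _) (proj₂ (proj₂ (nbr x)))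
    mono′ {suc x} {suc y} x≢y = mono (x≢y ∘ cong suc)

  fromClique : ∀ {i V a} → Clique i V a → Σ[ φ ∈ Copy (K a) n ] Monochromatic c φ
  fromClique C = record { embed = embed ; injective = injective } ,
    λ u≢v x≢y → trans (mono u≢v) (sym (mono x≢y))
    where
    open Clique C

  -- Induction on the sum of the clique orders

  rainbow-or-large-degree : ∀ {b} → 2 ≤ b → (T : Graph (suc b)) → IsTree T →
    ∀ m {V} → Unique V → b ^ suc m ≤ length V →
    RainbowCopy T ⊎ ∃₂ λ v i → v ∈ V × b ^ m ≤ length (nbrs i v V)
  rainbow-or-large-degree {b} 2≤b T tree zero {V} uV big
    -- The threshold is `b ^ 0`, that is 1. As `b ≥ 2` there are two vertices `v` and `w`, and `w`
    -- is a neighbor of `v` in the color of their edge.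
    with V | uV | ℕ.≤-trans 2≤b (subst (_≤ length V) (ℕ.*-identityʳ b) big)
  ... | v ∷ w ∷ V | (v≢w ∷ _) ∷ _ | _ = inj₂ (v , color v w , here refl ,
    filter-some (nbr? (color v w) v) {v ∷ w ∷ V} (there (here (v≢w ∘ sym , refl))))
  ... | _ ∷ [] | _ | s≤s ()
  rainbow-or-large-degree {b@(suc _)} 2≤b T tree (suc m) {V} uV big
    with Any.any? (λ v → any? λ i → b ^ suc m ℕ.≤? length (nbrs i v V)) V
  ... | yes large with v , v∈V , i , deg≥ ← find large = inj₂ (v , i , v∈V , deg≥)
  ... | no none
    with xs , o , all∈ ← tree⇒leafOrder T tree
    -- Writing the threshold as `suc q` makes `q` a bound on all degrees; `1 ≤ q` because the
    -- threshold is at least `b`.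
    with b ^ suc m | ℕ.≤-trans 2≤b (ℕ.m≤m*n b (b ^ m) ⦃ ℕ.m^n≢0 b m ⦄)
  ... | suc q | s≤s 1≤q = inj₁ (fromPartial T (embed-leafOrder T uV deg≤ o room V≢[]) all∈)
    where
    deg≤ : ∀ {v} → v ∈ V → ∀ i → length (nbrs i v V) ≤ q
    deg≤ v∈V i = ℕ.≤-pred (ℕ.≰⇒> λ ≥q → none (lose v∈V (i , ≥q)))
    room : ∀ l → suc l < length xs → suc l + l * q < length V
    room l l< = ℕ.<-≤-trans
      (room-to-attach 1≤q (ℕ.<-≤-trans l< (Unique⇒length≤ (leafOrder-unique T o)))) big
    V≢[] : 0 < length V
    V≢[] = ℕ.<-≤-trans (s≤s z≤n) big

  -- A clique in color `i` gains the vertex `v`; for any other color the target order was not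
  -- lowered.
  clique-increment : ∀ {V v i a} (t : Vec ℕ k) → v ∈ V → Vec.lookup t i ≡ suc a →
    (∃ λ j → Clique j (nbrs i v V) (Vec.lookup (t [ i ]≔ a) j)) →
    ∃ λ j → Clique j V (Vec.lookup t j)
  clique-increment {V} {v} {i} {a} t v∈V eq (j , C) with j ≟ i
  ... | yes refl = i , subst (Clique i V) (sym eq)
    (clique-cons v∈V (subst (Clique i (nbrs i v V)) (lookup∘update i t a) C))
  ... | no j≢i = j , subst (Clique j V) (lookup∘update′ j≢i t a)
    (clique-⊆ (proj₁ ∘ ∈-filter⁻ (nbr? i v)) C)

  rainbow-or-clique : ∀ {b} → 2 ≤ b → (T : Graph (suc b)) → IsTree T → Fin k →
    ∀ m (t : Vec ℕ k) → sum t ≡ m → ∀ {V} → Unique V → b ^ m ≤ length V →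
    RainbowCopy T ⊎ ∃ λ i → Clique i V (Vec.lookup t i)
  -- All target orders are 0, so the empty clique in any color will do; the argument `i` supplies
  -- one.
  rainbow-or-clique 2≤b T tree i zero t Σt _ _ =
    inj₂ (i , clique-0 i _ (ℕ.n≤0⇒n≡0 (subst (Vec.lookup t i ≤_) Σt (lookup≤sum t i))))
  rainbow-or-clique 2≤b T tree i₀ (suc m) t Σt {V} uV big
    with rainbow-or-large-degree 2≤b T tree m uV big
  ... | inj₁ rainbow = inj₁ rainbow
  ... | inj₂ (v , i , v∈V , deg≥) with Vec.lookup t i in eq
  -- A target of 0 cannot be lowered, but is already met by the empty clique.
  ...   | zero  = inj₂ (i , clique-0 i V eq)
  ...   | suc a = Sum.map₂ (clique-increment t v∈V eq)
    (rainbow-or-clique 2≤b T tree i₀ m (t [ i ]≔ a)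
      (ℕ.suc-injective (trans (sym (sum-decrement t i eq)) Σt))
      (filter⁺ (nbr? i v) uV) deg≥)

gallaiRamseyProperty : ∀ {b k} → 2 ≤ b → 1 ≤ k → (T : Graph (suc b)) → IsTree T → ∀ t →
                       GallaiRamseyProperty k T (K t) (b ^ (k * t))
gallaiRamseyProperty {b} {k} 2≤b 1≤k T tree t c =
  Sum.map₂ (λ { (i , C) → fromClique c (subst (Clique c i _) (lookup-replicate i t) C) })
    (rainbow-or-clique c 2≤b T tree (fromℕ< 1≤k) (k * t) (replicate k t) (sum-replicate k t)
      (allFin⁺ _) (ℕ.≤-reflexive (sym (length-tabulate (λ x → x)))))

-- Decidability of the Gallai–Ramsey property

-- `finToFun` enumerates all functions by a finite set of codes. Decoding a code recovers the
-- function only pointwise, so `P` must respect pointwise equality.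
∃-function? : {P : Pred (Fin m → Fin n) 0ℓ} → (∀ {f g} → f ≗ g → P f → P g) →
              Decidable P → Dec (∃ P)
∃-function? resp P? = map′
  (λ (i , p) → finToFun i , p)
  (λ (f , p) → funToFin f , resp (sym ∘ finToFun-funToFin f) p)
  (any? (P? ∘ finToFun))

∀-function? : {P : Pred (Fin m → Fin n) 0ℓ} → (∀ {f g} → f ≗ g → P f → P g) →
              Decidable P → Dec (∀ f → P f)
∀-function? resp P? = map′
  (λ p f → resp (finToFun-funToFin f) (p (funToFin f)))
  (λ p i → p (finToFun i))
  (all? (P? ∘ finToFun))

injective? : (f : Fin m → Fin n) → Dec (Injective _≡_ _≡_ f)
injective? f = map′ (λ inj {x} {y} → inj x y) (λ inj x y → inj)
  (all? λ x → all? λ y → (f x ≟ f y) →-dec (x ≟ y))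

_≈_ : (f g : Fin m → Fin m → Fin k) → Set
f ≈ g = ∀ u v → f u v ≡ g u v

module _ {a : ℕ} (G : Graph a) where
  open Graph G using (_~_; _~?_)

  -- Coloring and copy vary together, so one statement serves both for replacing the embedding and
  -- for replacing the coloring.
  RespectsColors : (∀ {k n} (c : Coloring k n) → Copy G n → Set) → Set
  RespectsColors P = ∀ {k n} (c c′ : Coloring k n) (φ φ′ : Copy G n) →
    (∀ u v → Coloring.color c (Copy.embed φ u) (Copy.embed φ v) ≡
             Coloring.color c′ (Copy.embed φ′ u) (Copy.embed φ′ v)) → P c φ → P c′ φ′

  rainbow-resp : RespectsColors (λ c φ → Rainbow c φ)
  rainbow-resp _ _ _ _ eq r u~v x~y same = r u~v x~y (trans (eq _ _) (trans same (sym (eq _ _))))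

  monochromatic-resp : RespectsColors (λ c φ → Monochromatic c φ)
  monochromatic-resp _ _ _ _ eq r u~v x~y = trans (sym (eq _ _)) (trans (r u~v x~y) (eq _ _))

  rainbow? : (c : Coloring k n) (φ : Copy G n) → Dec (Rainbow c φ)
  rainbow? c φ = map′ (λ r {u} {v} {x} {y} → r u v x y) (λ r u v x y → r)
    (all? λ u → all? λ v → all? λ x → all? λ y → (u ~? v) →-dec ((x ~? y) →-dec
      ((color (embed u) (embed v) ≟ color (embed x) (embed y)) →-dec
        (((u ≟ x) ×-dec (v ≟ y)) ⊎-dec ((u ≟ y) ×-dec (v ≟ x))))))
    where
    open Coloring c
    open Copy φ

  monochromatic? : (c : Coloring k n) (φ : Copy G n) → Dec (Monochromatic c φ)
  monochromatic? c φ = map′ (λ r {u} {v} {x} {y} → r u v x y) (λ r u v x y → r)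
    (all? λ u → all? λ v → all? λ x → all? λ y → (u ~? v) →-dec ((x ~? y) →-dec
      (color (embed u) (embed v) ≟ color (embed x) (embed y))))
    where
    open Coloring c
    open Copy φ

  copy? : (P : ∀ {k n} (c : Coloring k n) → Copy G n → Set) → RespectsColors P →
          (∀ {k n} (c : Coloring k n) φ → Dec (P c φ)) →
          (c : Coloring k n) → Dec (Σ[ φ ∈ Copy G n ] P c φ)
  copy? {k} {n} P resp P? c = map′
    (λ (f , inj , p) → record { embed = f ; injective = inj } , p)
    (λ (φ , p) → Copy.embed φ , (λ {x} {y} → Copy.injective φ {x} {y}) , p)
    (∃-function? respF F?)
    where
    open Coloring c
    F : (Fin a → Fin n) → Set
    F f = Σ[ inj ∈ Injective _≡_ _≡_ f ] P c (record { embed = f ; injective = inj })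
    respF : ∀ {f g} → f ≗ g → F f → F g
    respF f≗g (inj , p) =
      (λ eq → inj (trans (f≗g _) (trans eq (sym (f≗g _))))) ,
      resp c c _ _ (λ u v → cong₂ color (f≗g u) (f≗g v)) p
    F? : Decidable F
    F? f with injective? f
    ... | no ¬inj = no (¬inj ∘ proj₁)
    -- `P` could depend on the proof of injectivity; since the colors agree, the decision made for
    -- `inj` carries over to any other proof.
    ... | yes inj = map′ (inj ,_) (λ (_ , p) → resp c c _ _ (λ _ _ → refl) p) (P? c _)

-- Each row of a coloring is coded as an element of `Fin (k ^ n)`, so a coloring becomes a function
-- between finite sets. Codes that are not symmetric satisfy `F` vacuously.
∀-coloring? : {P : Coloring k n → Set} →
              (∀ {c c′} → Coloring.color c ≈ Coloring.color c′ → P c → P c′) →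
              Decidable P → Dec (∀ c → P c)
∀-coloring? {k} {n} {P} resp P? = map′
  (λ p c → let g = λ u → funToFin (Coloring.color c u)
               g≈c = λ u v → finToFun-funToFin (Coloring.color c u) v
           in resp g≈c (p g λ u v → trans (g≈c u v) (trans (Coloring.color-sym c u v) (sym (g≈c v u)))))
  (λ p g s → p (coloring g s))
  (∀-function? respF F?)
  where
  Symm : (Fin n → Fin (k ^ n)) → Set
  Symm g = ∀ u v → finToFun (g u) v ≡ finToFun (g v) u
  coloring : ∀ g → Symm g → Coloring k n
  coloring g s = record { color = λ u → finToFun (g u) ; color-sym = s }
  F : (Fin n → Fin (k ^ n)) → Set
  F g = ∀ s → P (coloring g s)
  respF : ∀ {f g} → f ≗ g → F f → F g
  respF {f} {g} f≗g p s =
    resp eq (p λ u v → trans (eq u v) (trans (s u v) (sym (eq v u))))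
    where
    eq : ∀ u v → finToFun (f u) v ≡ finToFun (g u) v
    eq u v = cong (λ i → finToFun i v) (f≗g u)
  F? : Decidable F
  F? g with all? (λ u → all? λ v → finToFun {k} {n} (g u) v ≟ finToFun (g v) u)
  ... | no ¬s = yes λ s → contradiction s ¬s
  ... | yes s = map′ (λ p _ → resp (λ _ _ → refl) p) (λ p → p s) (P? (coloring g s))

gallaiRamseyProperty? : ∀ {a b} k (G : Graph a) (H : Graph b) →
                        Decidable (GallaiRamseyProperty k G H)
gallaiRamseyProperty? k G H n = ∀-coloring?
  (λ {c} {c′} eq → Sum.map
    (λ (φ , r) → φ , λ {u} {v} {x} {y} →
      rainbow-resp G c c′ φ φ (λ _ _ → eq _ _) r {u} {v} {x} {y})
    (λ (φ , r) → φ , λ {u} {v} {x} {y} →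
      monochromatic-resp H c c′ φ φ (λ _ _ → eq _ _) r {u} {v} {x} {y}))
  (λ c → copy? G (λ c φ → Rainbow c φ) (rainbow-resp G) (rainbow? G) c
    ⊎-dec copy? H (λ c φ → Monochromatic c φ) (monochromatic-resp H) (monochromatic? H) c)

-- Existence of the Gallai-Ramsey number and its upper bound

theorem1p15 : (s t k : ℕ) → 3 ≤ s → 1 ≤ k → (T : Graph s) → IsTree T →
    GallaiRamseyNumber≤ k T (K t) ((s ∸ 1) ^ (k * t))
theorem1p15 (suc b) t k (s≤s 2≤b) 1≤k T tree
  with n , (holds , minimal) , n≤ ← least _ (gallaiRamseyProperty? k T (K t)) (b ^ (k * t))
         (gallaiRamseyProperty 2≤b 1≤k T tree t) =
  n , record { holds = holds ; minimal = minimal } , n≤
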